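{- Let $q\ge 4$ be a prime power and let $f\in\mathrm{Per}(\mathbb{F}_q^2)\setminus\mathrm{A\Gamma L}(2,\mathbb{F}_q)$. Then $1\text{ -coaffinity}(f)\ge 2q$.
   Context: $\mathrm{Per}(\mathbb{F}_q^2)$ is the group of permutations of $\mathbb{F}_q^2$. $\mathrm{A\Gamma L}(2,\mathbb{F}_q)$ is the group of invertible semi-affine maps of $\mathbb{F}_q^2$, i.e. maps $x\mapsto g(x)+b$ where $b\in\mathbb{F}_q^2$ and $g$ is a bijective additive map with $g(\alpha x)=\sigma(\alpha)g(x)$ for some field automorphism $\sigma$ of $\mathbb{F}_q$. A line ($1$-flat) is a coset of a $1$-dimensional subspace. $1\text{ -coaffinity}(f)$ is the number of lines $L$ such that $f(L)$ is not a line. -}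

module Defs where

open import Level using (0ℓ)
open import Data.Nat using (ℕ)
open import Data.Fin using (Fin)
open import Data.Product using (Σ; ∃; _×_; _,_; proj₁; proj₂)
open import Relation.Binary.PropositionalEquality using (_≡_)
open import Relation.Nullary using (¬_)
open import Function.Bundles using (_↔_)
open import Function.Definitions using (Bijective)
open import Algebra.Structures using (IsCommutativeRing)

-- A finite field with exactly q elements (equality is propositional).
-- Every finite field has prime-power order, and for each prime power q
-- there is (up to isomorphism) exactly one such field, F_q.
record FiniteField (q : ℕ) : Set₁ where
  infixl 7 _*_
  infixl 6 _+_
  field
    Carrier : Set
    _+_ _*_ : Carrier → Carrier → Carrier
    -_      : Carrier → Carrier
    0# 1#   : Carrier
    isCommutativeRing : IsCommutativeRing _≡_ _+_ _*_ -_ 0# 1#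
    0≢1     : ¬ (0# ≡ 1#)
    inverse : ∀ x → ¬ (x ≡ 0#) → Σ Carrier (λ y → x * y ≡ 1#)
    finite  : Carrier ↔ Fin q

module Plane {q : ℕ} (F : FiniteField q) where
  open FiniteField F

  Point : Set
  Point = Carrier × Carrier

  _⊕_ : Point → Point → Point
  (a , b) ⊕ (c , d) = (a + c , b + d)

  _·_ : Carrier → Point → Point
  t · (a , b) = (t * a , t * b)

  zeroP : Point
  zeroP = (0# , 0#)

  record FieldAut : Set where
    field
      σ      : Carrier → Carrier
      σ-bij  : Bijective _≡_ _≡_ σ
      σ-+    : ∀ a b → σ (a + b) ≡ σ a + σ b
      σ-*    : ∀ a b → σ (a * b) ≡ σ a * σ b
      σ-1    : σ 1# ≡ 1#

  IsSemiAffine : (Point → Point) → Set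
  IsSemiAffine f =
    Σ FieldAut λ S → Σ (Point → Point) λ g → Σ Point λ b →
      Bijective _≡_ _≡_ g
      × (∀ x y → g (x ⊕ y) ≡ g x ⊕ g y)
      × (∀ α x → g (α · x) ≡ FieldAut.σ S α · g x)
      × (∀ x → f x ≡ g x ⊕ b)

  record Line : Set where
    constructor line
    field
      base : Point
      dir  : Point
      dir≢0 : ¬ (dir ≡ zeroP)

  _∈L_ : Point → Line → Set
  x ∈L L = Σ Carrier λ t → x ≡ Line.base L ⊕ (t · Line.dir L)

  SameLine : Line → Line → Set
  SameLine L M = ∀ x → (x ∈L L → x ∈L M) × (x ∈L M → x ∈L L)

  ImageIsLine : (Point → Point) → Line → Set
  ImageIsLine f L = Σ Line λ M →
    ∀ y → (y ∈L M → Σ Point (λ x → x ∈L L × f x ≡ y))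
        × (Σ Point (λ x → x ∈L L × f x ≡ y) → y ∈L M)

  CoaffinityAtLeast : (Point → Point) → ℕ → Set
  CoaffinityAtLeast f n =
    Σ (Fin n → Line) λ Ls →
      (∀ i j → SameLine (Ls i) (Ls j) → i ≡ j)
      × (∀ i → ¬ ImageIsLine f (Ls i))

{-# OPTIONS --safe #-}
module Submission where

-- If every line is the image of a line, f is a collineation, hence semi-affine by the
-- fundamental theorem of affine geometry. Otherwise some line has a preimage S, a set of q
-- points that is not a line. A line meeting S twice is bad (its image is not a line), and the
-- good lines missing S have images parallel to the given line, so they all lie in one parallel
-- class C. Within another class, S has q points for q lines, so the lines that do not meet S in
-- exactly one point, all of them bad, are as many as the points s of S lying on a secant of
-- that class. If every s lies on two secants outside C, this gives 2q bad lines. Otherwise S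
-- lies on two lines M and N through some s₀, with N in C; fixing α₀ on M and β₀ on N, the points
-- of S on the secants M, α₀β and αβ₀ (α on M, β on N) give 2q - 2 pairs (class, point), and two
-- bad lines in C complete the count, for a class cannot contain exactly one bad line.

open import Defs
open import Level using (0ℓ)
open import Algebra.Bundles using (CommutativeRing)
open import Algebra.Structures using (IsCommutativeRing)
import Algebra.Properties.Ring as RingProperties
import Algebra.Properties.CommutativeSemigroup as CommutativeSemigroupProperties
open import Data.Empty using (⊥-elim)
open import Data.Fin using (Fin; punchOut; combine; remQuot)
open import Data.Fin.Patterns using (0F; 1F)
import Data.Fin.Properties as Fin
open import Data.List using (List; []; _∷_; map; allFin)
open import Data.List.Membership.Propositional using (_∈_)
open import Data.List.Membership.Propositional.Properties using (∈-map⁺; ∈-allFin)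
open import Data.List.Relation.Unary.Any using (here; there)
open import Data.Maybe using (Maybe; just; nothing)
open import Data.Maybe.Properties using (≡-dec)
open import Data.Nat using (ℕ; _≤_)
import Data.Nat as Nat
open import Data.Nat.Properties using (1+n≰n)
open import Data.Product using (Σ; ∃; _×_; _,_; proj₁; proj₂)
open import Data.Sum using (inj₁; inj₂)
open import Function using (_∘_)
open import Function.Bundles using (_↔_; Inverse)
open import Function.Definitions using (Injective)
open import Relation.Binary.Definitions using (DecidableEquality)
open import Relation.Binary.PropositionalEquality
open import Relation.Nullary using (¬_; Dec; yes; no; ¬?)
open import Relation.Nullary.Decidable using (map′; _×-dec_; _⊎-dec_; _→-dec_; decidable-stable)
open import Relation.Unary using (Decidable)

-- Pigeonhole and permutations on finite types.

private
  to-injective : {A B : Set} (i : A ↔ B) → Injective _≡_ _≡_ (Inverse.to i)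
  to-injective i {x} {y} e = trans (sym (Inverse.strictlyInverseʳ i x))
    (trans (cong (Inverse.from i) e) (Inverse.strictlyInverseʳ i y))

  from-injective : {A B : Set} (i : A ↔ B) → Injective _≡_ _≡_ (Inverse.from i)
  from-injective i {x} {y} e = trans (sym (Inverse.strictlyInverseˡ i x))
    (trans (cong (Inverse.to i) e) (Inverse.strictlyInverseˡ i y))

-- A missed value could be punched out of the codomain, leaving an injection into a smaller `Fin`.
Fin-injective⇒surjective : ∀ {n} (f : Fin n → Fin n) → Injective _≡_ _≡_ f →
  ∀ y → ∃ λ x → f x ≡ y
Fin-injective⇒surjective {ℕ.suc n} f inj y with Fin.any? (λ x → f x Fin.≟ y)
... | yes hit = hit
... | no miss = ⊥-elim (1+n≰n (Fin.injective⇒≤ {f = squeeze} squeeze-injective))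
  where
  avoids : ∀ x → y ≢ f x
  avoids x e = miss (x , sym e)
  squeeze : Fin (ℕ.suc n) → Fin n
  squeeze x = punchOut (avoids x)
  squeeze-injective : Injective _≡_ _≡_ squeeze
  squeeze-injective {a} {b} e = inj (Fin.punchOut-injective (avoids a) (avoids b) e)

module Finite {A : Set} {n : ℕ} (A↔Fin : A ↔ Fin n) where
  open Inverse A↔Fin using (to; from; strictlyInverseʳ)

  infix 4 _≟_
  _≟_ : DecidableEquality A
  x ≟ y = map′ (to-injective A↔Fin) (cong to) (to x Fin.≟ to y)

  any? : {P : A → Set} → Decidable P → Dec (∃ P)
  any? {P} P? = map′ (λ (i , p) → from i , p)
    (λ (x , p) → to x , subst P (sym (strictlyInverseʳ x)) p) (Fin.any? (P? ∘ from))

  ¬∃¬⇒∀ : {P : A → Set} → Decidable P → ¬ (∃ λ x → ¬ P x) → ∀ x → P x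
  ¬∃¬⇒∀ P? ¬∃ x = decidable-stable (P? x) λ ¬p → ¬∃ (x , ¬p)

  all? : {P : A → Set} → Decidable P → Dec (∀ x → P x)
  all? P? with any? (¬? ∘ P?)
  ... | yes (x , ¬p) = no λ all → ¬p (all x)
  ... | no ¬∃ = yes (¬∃¬⇒∀ P? ¬∃)

  ¬∀⇒∃¬ : {P : A → Set} → Decidable P → ¬ (∀ x → P x) → ∃ λ x → ¬ P x
  ¬∀⇒∃¬ P? ¬∀ = decidable-stable (any? (¬? ∘ P?)) λ ¬∃ → ¬∀ (¬∃¬⇒∀ P? ¬∃)

  injective⇒surjective : (f : A → A) → Injective _≡_ _≡_ f → ∀ y → ∃ λ x → f x ≡ y
  injective⇒surjective f inj y =
    let i , e = Fin-injective⇒surjective (to ∘ f ∘ from)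
                  (from-injective A↔Fin ∘ inj ∘ to-injective A↔Fin) (to y)
    in from i , to-injective A↔Fin e

  -- A section of `f` is injective, hence surjective, so every element is the section of its own
  -- image.
  surjective⇒injective : (f : A → A) → (∀ y → ∃ λ x → f x ≡ y) → Injective _≡_ _≡_ f
  surjective⇒injective f sur {x} {y} e =
    let section = λ z → proj₁ (sur z)
        fs = λ z → proj₂ (sur z)
        section-injective = λ {a} {b} p → trans (sym (fs a)) (trans (cong f p) (fs b))
        a , a↦x = injective⇒surjective section section-injective x
        b , b↦y = injective⇒surjective section section-injective y
        a≡b = trans (sym (fs a)) (trans (cong f a↦x) (trans e (trans (cong f (sym b↦y)) (fs b))))
    in trans (sym a↦x) (trans (cong section a≡b) b↦y)

  elements : List A
  elements = map from (allFin n)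

  ∈-elements : ∀ x → x ∈ elements
  ∈-elements x = subst (_∈ elements) (strictlyInverseʳ x) (∈-map⁺ from (∈-allFin (to x)))

  swap : A → A → A → A
  swap a b x with x ≟ a | x ≟ b
  ... | yes _ | _ = b
  ... | no _ | yes _ = a
  ... | no _ | no _ = x

  swap-left : ∀ a b → swap a b a ≡ b
  swap-left a b with a ≟ a | a ≟ b
  ... | yes _ | _ = refl
  ... | no a≢a | _ = ⊥-elim (a≢a refl)

  swap-other : ∀ {a b x} → x ≢ a → x ≢ b → swap a b x ≡ x
  swap-other {a} {b} {x} x≢a x≢b with x ≟ a | x ≟ b
  ... | yes e | _ = ⊥-elim (x≢a e)
  ... | no _ | yes e = ⊥-elim (x≢b e)
  ... | no _ | no _ = refl

  swap-injective : ∀ a b → Injective _≡_ _≡_ (swap a b)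
  swap-injective a b {x} {y} e with x ≟ a | x ≟ b | y ≟ a | y ≟ b
  ... | yes p | _ | yes r | _ = trans p (sym r)
  ... | yes p | _ | no _ | yes s = trans p (trans (sym e) (sym s))
  ... | yes p | _ | no _ | no s = ⊥-elim (s (sym e))
  ... | no _ | yes p | yes r | _ = trans p (trans (sym e) (sym r))
  ... | no _ | yes p | no _ | yes s = trans p (sym s)
  ... | no _ | yes p | no r | no _ = ⊥-elim (r (sym e))
  ... | no _ | no p | yes _ | _ = ⊥-elim (p e)
  ... | no p | no _ | no _ | yes _ = ⊥-elim (p e)
  ... | no _ | no _ | no _ | no _ = e

  Lonely : (A → A) → A → Set
  Lonely φ x = ∀ y → φ y ≡ φ x → y ≡ x

  Crowded : (A → A) → A → Set
  Crowded φ x = ∃ λ y → y ≢ x × φ y ≡ φ x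

  crowded? : ∀ φ → Decidable (Crowded φ)
  crowded? φ x = any? λ y → ¬? (y ≟ x) ×-dec (φ y ≟ φ x)

  ¬crowded⇒lonely : ∀ {φ x} → ¬ Crowded φ x → Lonely φ x
  ¬crowded⇒lonely {φ} {x} ¬c y e = decidable-stable (y ≟ x) λ y≢x → ¬c (y , y≢x , e)

  -- Lonely points have distinct values, so `φ` restricted to them extends to a permutation. It is
  -- built one element at a time, a transposition after `π` correcting the value at `a`.
  lonelyExtensionOn : ∀ φ (xs : List A) →
    Σ (A → A) λ π → Injective _≡_ _≡_ π × (∀ x → x ∈ xs → Lonely φ x → π x ≡ φ x)
  lonelyExtensionOn φ [] = (λ x → x) , (λ e → e) , λ _ ()
  lonelyExtensionOn φ (a ∷ xs) with crowded? φ a | lonelyExtensionOn φ xs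
  ... | yes (b , b≢a , e) | π , inj , ext = π , inj , ext′
    where
    ext′ : ∀ x → x ∈ a ∷ xs → Lonely φ x → π x ≡ φ x
    ext′ x (here refl) lonely = ⊥-elim (b≢a (lonely b e))
    ext′ x (there x∈xs) lonely = ext x x∈xs lonely
  ... | no ¬c | π , inj , ext = swap (π a) (φ a) ∘ π , inj ∘ swap-injective _ _ , ext′
    where
    ext′ : ∀ x → x ∈ a ∷ xs → Lonely φ x → swap (π a) (φ a) (π x) ≡ φ x
    ext′ x (here refl) _ = swap-left _ _
    ext′ x (there x∈xs) lonely with x ≟ a
    ... | yes refl = swap-left _ _
    -- The transposition fixes `π x`, which differs from `π a` as `π` is injective and from `φ a` as
    -- `a` is lonely.
    ... | no x≢a = trans (swap-other (x≢a ∘ inj)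
            (λ e → x≢a (¬crowded⇒lonely ¬c x (trans (sym (ext x x∈xs lonely)) e))))
            (ext x x∈xs lonely)

  -- Applied to `φ d` below, it matches the points of `S` on secants of class `d` with the lines of
  -- that class not meeting `S` exactly once, without computing cardinalities.
  lonelyExtension : (A → A) → A → A
  lonelyExtension φ = proj₁ (lonelyExtensionOn φ elements)

  lonelyExtension-injective : ∀ φ → Injective _≡_ _≡_ (lonelyExtension φ)
  lonelyExtension-injective φ = proj₁ (proj₂ (lonelyExtensionOn φ elements))

  lonelyExtension-lonely : ∀ φ x → Lonely φ x → lonelyExtension φ x ≡ φ x
  lonelyExtension-lonely φ x = proj₂ (proj₂ (lonelyExtensionOn φ elements)) x (∈-elements x)

  -- So the extension maps crowded points to values with no or several preimages under φ.
  lonelyExtension-crowded : ∀ φ x y → Crowded φ x → φ y ≡ lonelyExtension φ x → Crowded φ y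
  lonelyExtension-crowded φ x y (z , z≢x , e) φy≡πx = decidable-stable (crowded? φ y) λ ¬c →
    let lonely = ¬crowded⇒lonely ¬c
        y≡x = lonelyExtension-injective φ
                (trans (lonelyExtension-lonely φ y lonely) φy≡πx)
    in ¬c (z , (λ z≡y → z≢x (trans z≡y y≡x)) , trans e (cong φ (sym y≡x)))

-- Coordinates and incidence in the affine plane.

module Geometry {q : ℕ} (F : FiniteField q) where
  open FiniteField F public
  open Plane F public
  open Finite finite public
  open IsCommutativeRing isCommutativeRing public
    using (+-assoc; +-comm; +-identityˡ; +-identityʳ; -‿inverseˡ; -‿inverseʳ; *-assoc; *-comm; *-identityˡ; *-identityʳ; distribˡ; distribʳ; zeroˡ; zeroʳ)

  ring : CommutativeRing 0ℓ 0ℓ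
  ring = record { isCommutativeRing = isCommutativeRing }

  open RingProperties (CommutativeRing.ring ring) public
    using (-‿distribˡ-*; +-cancelˡ; +-cancelʳ)
  open CommutativeSemigroupProperties (CommutativeRing.+-commutativeSemigroup ring) public
    using () renaming (interchange to +-interchange)
  open CommutativeSemigroupProperties (CommutativeRing.*-commutativeSemigroup ring) public
    using () renaming (x∙yz≈y∙xz to *-left-comm)

  open ≡-Reasoning

  *-cancelʳ : ∀ {a b x} → x ≢ 0# → a * x ≡ b * x → a ≡ b
  *-cancelʳ {a} {b} {x} x≢0 e with inverse x x≢0
  ... | w , xw≡1 = begin
    a            ≡⟨ *-identityʳ a ⟨
    a * 1#       ≡⟨ cong (a *_) xw≡1 ⟨
    a * (x * w)  ≡⟨ *-assoc a x w ⟨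
    a * x * w    ≡⟨ cong (_* w) e ⟩
    b * x * w    ≡⟨ *-assoc b x w ⟩
    b * (x * w)  ≡⟨ cong (b *_) xw≡1 ⟩
    b * 1#       ≡⟨ *-identityʳ b ⟩
    b            ∎

  [x-y]+y≡x : ∀ x y → x + - y + y ≡ x
  [x-y]+y≡x x y = trans (+-assoc x (- y) y) (trans (cong (x +_) (-‿inverseˡ y)) (+-identityʳ x))

  infixl 6 _⊝_
  _⊝_ : Point → Point → Point
  (a , b) ⊝ (c , d) = a + - c , b + - d

  [P⊝Q]⊕Q≡P : ∀ P Q → (P ⊝ Q) ⊕ Q ≡ P
  [P⊝Q]⊕Q≡P (a , b) (c , d) = cong₂ _,_ ([x-y]+y≡x a c) ([x-y]+y≡x b d)

  ⊕-assoc : ∀ P Q R → (P ⊕ Q) ⊕ R ≡ P ⊕ (Q ⊕ R)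
  ⊕-assoc (a , b) (c , d) (e , f) = cong₂ _,_ (+-assoc a c e) (+-assoc b d f)

  ⊕-comm : ∀ P Q → P ⊕ Q ≡ Q ⊕ P
  ⊕-comm (a , b) (c , d) = cong₂ _,_ (+-comm a c) (+-comm b d)

  ⊕-identityˡ : ∀ P → zeroP ⊕ P ≡ P
  ⊕-identityˡ (a , b) = cong₂ _,_ (+-identityˡ a) (+-identityˡ b)

  ⊕-cancelʳ : ∀ {P Q} R → P ⊕ R ≡ Q ⊕ R → P ≡ Q
  ⊕-cancelʳ {a , b} {c , d} (e , f) eq =
    cong₂ _,_ (+-cancelʳ e a c (cong proj₁ eq)) (+-cancelʳ f b d (cong proj₂ eq))

  ·-distribʳ : ∀ s t P → (s + t) · P ≡ (s · P) ⊕ (t · P)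
  ·-distribʳ s t (a , b) = cong₂ _,_ (distribʳ a s t) (distribʳ b s t)

  ·-assoc : ∀ s t P → (s * t) · P ≡ s · (t · P)
  ·-assoc s t (a , b) = cong₂ _,_ (*-assoc s t a) (*-assoc s t b)

  ·-identityˡ : ∀ P → 1# · P ≡ P
  ·-identityˡ (a , b) = cong₂ _,_ (*-identityˡ a) (*-identityˡ b)

  ·-cancelʳ : ∀ {s t P} → P ≢ zeroP → s · P ≡ t · P → s ≡ t
  ·-cancelʳ {s} {t} {a , b} P≢0 e with a ≟ 0# | b ≟ 0#
  ... | no a≢0 | _ = *-cancelʳ a≢0 (cong proj₁ e)
  ... | yes _ | no b≢0 = *-cancelʳ b≢0 (cong proj₂ e)
  ... | yes refl | yes refl = ⊥-elim (P≢0 refl)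

  -- The direction  just m  consists of the lines y + m x = c, so m is minus the slope;
  -- nothing  consists of the lines x = c.
  Direction : Set
  Direction = Maybe Carrier

  infix 4 _≟ᵈ_
  _≟ᵈ_ : DecidableEquality Direction
  _≟ᵈ_ = ≡-dec _≟_

  -- A linear functional whose level sets are the lines of direction `d`. Each line is thus a unique
  -- pair `(d , c)`, and incidence is an equation in the field.
  ι : Direction → Point → Carrier
  ι (just m) (x , y) = y + m * x
  ι nothing  (x , y) = x

  ι-⊕ : ∀ d P Q → ι d (P ⊕ Q) ≡ ι d P + ι d Q
  ι-⊕ (just m) (a , b) (c , d) =
    trans (cong (b + d +_) (distribˡ m a c)) (+-interchange b d (m * a) (m * c))
  ι-⊕ nothing P Q = refl

  ι-· : ∀ d t P → ι d (t · P) ≡ t * ι d P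
  ι-· (just m) t (a , b) =
    trans (cong (t * b +_) (*-left-comm m t a)) (sym (distribˡ t b (m * a)))
  ι-· nothing t P = refl

  ι-zero : ∀ d → ι d zeroP ≡ 0#
  ι-zero (just m) = trans (+-identityˡ _) (zeroʳ m)
  ι-zero nothing = refl

  ι-⊕-kernelˡ : ∀ d {P} Q → ι d P ≡ 0# → ι d (P ⊕ Q) ≡ ι d Q
  ι-⊕-kernelˡ d {P} Q e = trans (ι-⊕ d P Q) (trans (cong (_+ ι d Q) e) (+-identityˡ _))

  ι-⊕-kernelʳ : ∀ d P {Q} → ι d Q ≡ 0# → ι d (P ⊕ Q) ≡ ι d P
  ι-⊕-kernelʳ d P {Q} e = trans (ι-⊕ d P Q) (trans (cong (ι d P +_) e) (+-identityʳ _))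

  ι-⊝⇒≡ : ∀ d P Q → ι d (P ⊝ Q) ≡ 0# → ι d P ≡ ι d Q
  ι-⊝⇒≡ d P Q e = trans (cong (ι d) (sym ([P⊝Q]⊕Q≡P P Q))) (ι-⊕-kernelˡ d Q e)

  ≡⇒ι-⊝ : ∀ d P Q → ι d P ≡ ι d Q → ι d (P ⊝ Q) ≡ 0#
  ≡⇒ι-⊝ d P Q e = +-cancelʳ (ι d Q) _ _ (begin
    ι d (P ⊝ Q) + ι d Q  ≡⟨ ι-⊕ d (P ⊝ Q) Q ⟨
    ι d ((P ⊝ Q) ⊕ Q)    ≡⟨ cong (ι d) ([P⊝Q]⊕Q≡P P Q) ⟩
    ι d P                ≡⟨ e ⟩
    ι d Q                ≡⟨ +-identityˡ _ ⟨
    0# + ι d Q           ∎)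

  kernel-intersection : ∀ {d e} → d ≢ e → ∀ P → ι d P ≡ 0# → ι e P ≡ 0# → P ≡ zeroP
  kernel-intersection {just m} {just n} d≢e (x , y) p r with x ≟ 0#
  ... | yes refl = cong (0# ,_) (trans (sym (trans (cong (y +_) (zeroʳ m)) (+-identityʳ y))) p)
  ... | no x≢0 = ⊥-elim (d≢e (cong just (*-cancelʳ x≢0 (+-cancelˡ y _ _ (trans p (sym r))))))
  kernel-intersection {just m} {nothing} d≢e (x , y) p refl =
    cong (0# ,_) (trans (sym (trans (cong (y +_) (zeroʳ m)) (+-identityʳ y))) p)
  kernel-intersection {nothing} {just m} d≢e (x , y) refl p =
    cong (0# ,_) (trans (sym (trans (cong (y +_) (zeroʳ m)) (+-identityʳ y))) p)
  kernel-intersection {nothing} {nothing} d≢e P _ _ = ⊥-elim (d≢e refl)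

  meet-unique : ∀ {d e P Q} → d ≢ e → ι d P ≡ ι d Q → ι e P ≡ ι e Q → P ≡ Q
  meet-unique {d} {e} {P} {Q} d≢e p r = begin
    P              ≡⟨ [P⊝Q]⊕Q≡P P Q ⟨
    (P ⊝ Q) ⊕ Q    ≡⟨ cong (_⊕ Q) (kernel-intersection d≢e (P ⊝ Q) (≡⇒ι-⊝ d P Q p) (≡⇒ι-⊝ e P Q r)) ⟩
    zeroP ⊕ Q      ≡⟨ ⊕-identityˡ Q ⟩
    Q              ∎

  join-unique : ∀ {d e P Q} → P ≢ Q → ι d P ≡ ι d Q → ι e P ≡ ι e Q → d ≡ e
  join-unique {d} {e} P≢Q p r = decidable-stable (d ≟ᵈ e) λ d≢e → P≢Q (meet-unique d≢e p r)

  -- One vector of the basis dual to `ι d` and `ι e`; exchanging `d` and `e` gives the other, and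
  -- `meet` combines the two.
  dual : ∀ {d e} → d ≢ e → Σ Point λ P → ι d P ≡ 1# × ι e P ≡ 0#
  dual {just m} {just n} d≢e with inverse (m + - n) (λ z → d≢e (cong just
    (trans (sym ([x-y]+y≡x m n)) (trans (cong (_+ n) z) (+-identityˡ n)))))
  -- The vector (1, -n) spans the kernel of `ι (just n)` and has value m - n under `ι (just m)`, so
  -- it is scaled by the inverse `w`.
  ... | w , [m-n]w≡1 = (w , - (n * w)) , one , -‿inverseˡ (n * w)
    where
    one : - (n * w) + m * w ≡ 1#
    one = begin
      - (n * w) + m * w  ≡⟨ +-comm _ _ ⟩
      m * w + - (n * w)  ≡⟨ cong (m * w +_) (-‿distribˡ-* n w) ⟩
      m * w + - n * w    ≡⟨ distribʳ w m (- n) ⟨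
      (m + - n) * w      ≡⟨ [m-n]w≡1 ⟩
      1#                 ∎
  dual {just m} {nothing} d≢e =
    (0# , 1#) , trans (cong (1# +_) (zeroʳ m)) (+-identityʳ 1#) , refl
  dual {nothing} {just m} d≢e = (1# , - (m * 1#)) , refl , -‿inverseˡ (m * 1#)
  dual {nothing} {nothing} d≢e = ⊥-elim (d≢e refl)

  meet : ∀ {d e} → d ≢ e → ∀ a b → Σ Point λ P → ι d P ≡ a × ι e P ≡ b
  meet {d} {e} d≢e a b with dual d≢e | dual {e} {d} (d≢e ∘ sym)
  ... | P , dP , eP | Q , eQ , dQ = (a · P) ⊕ (b · Q) , atD , atE
    where
    scaled : ∀ d′ t R {u} → ι d′ R ≡ u → ι d′ (t · R) ≡ t * u
    scaled d′ t R e′ = trans (ι-· d′ t R) (cong (t *_) e′)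
    atD : ι d ((a · P) ⊕ (b · Q)) ≡ a
    atD = trans (ι-⊕-kernelʳ d (a · P) (trans (scaled d b Q dQ) (zeroʳ b)))
            (trans (scaled d a P dP) (*-identityʳ a))
    atE : ι e ((a · P) ⊕ (b · Q)) ≡ b
    atE = trans (ι-⊕-kernelˡ e (b · Q) (trans (scaled e a P eP) (zeroʳ a)))
            (trans (scaled e b Q eQ) (*-identityʳ b))

  direction : ∀ P → Σ Direction λ d → ι d P ≡ 0#
  direction (x , y) with x ≟ 0#
  -- The zero vector lies in every kernel and is assigned `nothing`, so `join` is total.
  ... | yes x≡0 = nothing , x≡0
  ... | no x≢0 with inverse x x≢0
  ... | w , xw≡1 = just (- (y * w)) , (begin
    y + - (y * w) * x    ≡⟨ cong (y +_) (-‿distribˡ-* (y * w) x) ⟨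
    y + - (y * w * x)    ≡⟨ cong (λ z → y + - z) (*-assoc y w x) ⟩
    y + - (y * (w * x))  ≡⟨ cong (λ z → y + - (y * z)) (trans (*-comm w x) xw≡1) ⟩
    y + - (y * 1#)       ≡⟨ cong (λ z → y + - z) (*-identityʳ y) ⟩
    y + - y              ≡⟨ -‿inverseʳ y ⟩
    0#                   ∎)

  join : Point → Point → Direction
  join P Q = proj₁ (direction (P ⊝ Q))

  join-incident : ∀ P Q → ι (join P Q) P ≡ ι (join P Q) Q
  join-incident P Q = ι-⊝⇒≡ (join P Q) P Q (proj₂ (direction (P ⊝ Q)))

  another : ∀ d → Σ Direction λ e → d ≢ e
  another (just m) = nothing , λ ()
  another nothing = just 0# , λ ()

  -- For another direction `e`, `ι e` is nonzero at `u`, and the ratio of its values at `v` and `u`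
  -- is the coefficient.
  kernel-span : ∀ d {u v} → u ≢ zeroP → ι d u ≡ 0# → ι d v ≡ 0# → Σ Carrier λ t → v ≡ t · u
  kernel-span d {u} {v} u≢0 du dv =
    let e , d≢e = another d
        w , eu*w≡1 = inverse (ι e u) λ eu → u≢0 (kernel-intersection d≢e u du eu)
        t = ι e v * w
    in t , meet-unique d≢e
      (trans dv (sym (trans (ι-· d t u) (trans (cong (t *_) du) (zeroʳ t)))))
      (begin
        ι e v                  ≡⟨ *-identityʳ _ ⟨
        ι e v * 1#             ≡⟨ cong (ι e v *_) (trans (*-comm w (ι e u)) eu*w≡1) ⟨
        ι e v * (w * ι e u)    ≡⟨ *-assoc _ w _ ⟨
        t * ι e u              ≡⟨ ι-· e t u ⟨
        ι e (t · u)            ∎)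

  point : Direction → Carrier → Carrier → Point
  point (just m) c k = k , c + - (m * k)
  point nothing  c k = c , k

  point-ι : ∀ d c k → ι d (point d c k) ≡ c
  point-ι (just m) c k = [x-y]+y≡x c (m * k)
  point-ι nothing c k = refl

  point-injective : ∀ d c → Injective _≡_ _≡_ (point d c)
  point-injective (just m) c e = cong proj₁ e
  point-injective nothing c e = cong proj₂ e

  point-surjective : ∀ d P → Σ Carrier λ k → P ≡ point d (ι d P) k
  point-surjective (just m) (x , y) = x , cong (x ,_) (sym (begin
    y + m * x + - (m * x)    ≡⟨ +-assoc y _ _ ⟩
    y + (m * x + - (m * x))  ≡⟨ cong (y +_) (-‿inverseʳ (m * x)) ⟩
    y + 0#                   ≡⟨ +-identityʳ y ⟩
    y                        ∎))
  point-surjective nothing (x , y) = y , refl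

  -- Two distinct points of the first line already fix the second.
  ⊆⇒≡ : ∀ {d c e b} → (∀ P → ι d P ≡ c → ι e P ≡ b) → d ≡ e × c ≡ b
  ⊆⇒≡ {d} {c} {e} {b} sub
    with join-unique {d} {e} {point d c 0#} {point d c 1#} (0≢1 ∘ point-injective d c)
           (trans (point-ι d c 0#) (sym (point-ι d c 1#)))
           (trans (sub _ (point-ι d c 0#)) (sym (sub _ (point-ι d c 1#))))
  ... | refl = refl , trans (sym (point-ι d c 0#)) (sub _ (point-ι d c 0#))

  ∈L⇒ι : ∀ L d → ι d (Line.dir L) ≡ 0# → ∀ {P} → P ∈L L → ι d P ≡ ι d (Line.base L)
  ∈L⇒ι (line B v _) d dv (t , refl) =
    ι-⊕-kernelʳ d B (trans (ι-· d t v) (trans (cong (t *_) dv) (zeroʳ t)))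

  ι⇒∈L : ∀ L d → ι d (Line.dir L) ≡ 0# → ∀ {P} → ι d P ≡ ι d (Line.base L) → P ∈L L
  ι⇒∈L (line B v v≢0) d dv {P} e with kernel-span d v≢0 dv (≡⇒ι-⊝ d P B e)
  ... | t , P⊝B≡tv = t , trans (sym ([P⊝Q]⊕Q≡P P B)) (trans (⊕-comm (P ⊝ B) B) (cong (B ⊕_) P⊝B≡tv))

  kernel-vector : ∀ d → Σ Point λ v → v ≢ zeroP × ι d v ≡ 0#
  kernel-vector d with another d
  ... | e , d≢e with dual {e} {d} (d≢e ∘ sym)
  ... | v , ev≡1 , dv≡0 = v , (λ v≡0 → 0≢1 (trans (sym (ι-zero e)) (trans (cong (ι e) (sym v≡0)) ev≡1))) , dv≡0

  toLine : Direction × Carrier → Line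
  toLine (d , c) = line (point d c 0#) (proj₁ (kernel-vector d)) (proj₁ (proj₂ (kernel-vector d)))

  toLine⇒ι : ∀ d c {P} → P ∈L toLine (d , c) → ι d P ≡ c
  toLine⇒ι d c P∈ = trans (∈L⇒ι (toLine (d , c)) d (proj₂ (proj₂ (kernel-vector d))) P∈) (point-ι d c 0#)

  ι⇒toLine : ∀ d c {P} → ι d P ≡ c → P ∈L toLine (d , c)
  ι⇒toLine d c e = ι⇒∈L (toLine (d , c)) d (proj₂ (proj₂ (kernel-vector d))) (trans e (sym (point-ι d c 0#)))

  toLine-injective : ∀ ℓ m → SameLine (toLine ℓ) (toLine m) → ℓ ≡ m
  toLine-injective (d , c) (e , b) same
    with ⊆⇒≡ {d} {c} {e} {b} (λ P → toLine⇒ι e b ∘ proj₁ (same P) ∘ ι⇒toLine d c)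
  ... | refl , refl = refl

  anyᵈ? : {P : Direction → Set} → Decidable P → Dec (∃ P)
  anyᵈ? {P} P? = map′ (λ { (inj₁ p) → nothing , p ; (inj₂ (m , p)) → just m , p })
    (λ { (nothing , p) → inj₁ p ; (just m , p) → inj₂ (m , p) })
    (P? nothing ⊎-dec any? (P? ∘ just))

  allᵖ? : {P : Point → Set} → Decidable P → Dec (∀ x → P x)
  allᵖ? P? = map′ (λ h (x , y) → h x y) (λ h x y → h (x , y)) (all? λ x → all? λ y → P? (x , y))

-- Lines and their images under a permutation.

module Permutation {q : ℕ} (F : FiniteField q) (perm : Plane.Point F ↔ Plane.Point F) where
  open Geometry F
  open Inverse perm using () renaming (to to f; from to f⁻¹; strictlyInverseˡ to f∘f⁻¹)
  open ≡-Reasoning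

  f-injective : Injective _≡_ _≡_ f
  f-injective = to-injective perm

  -- As `f` is a bijection, an equivalence at every point says that one line is exactly the image of
  -- the other, and search decides it.
  Maps : Direction × Carrier → Direction × Carrier → Set
  Maps (d , c) (e , b) = ∀ P → (ι d P ≡ c → ι e (f P) ≡ b) × (ι e (f P) ≡ b → ι d P ≡ c)

  HasImage HasPreimage : Direction × Carrier → Set
  HasImage ℓ = ∃ λ m → Maps ℓ m
  HasPreimage m = ∃ λ ℓ → Maps ℓ m

  maps? : ∀ ℓ m → Dec (Maps ℓ m)
  maps? (d , c) (e , b) = allᵖ? λ P →
    ((ι d P ≟ c) →-dec (ι e (f P) ≟ b)) ×-dec ((ι e (f P) ≟ b) →-dec (ι d P ≟ c))

  anyˡ? : {P : Direction × Carrier → Set} → Decidable P → Dec (∃ P)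
  anyˡ? P? = map′ (λ (d , c , p) → (d , c) , p) (λ ((d , c) , p) → d , c , p)
    (anyᵈ? λ d → any? λ c → P? (d , c))

  hasImage? : Decidable HasImage
  hasImage? ℓ = anyˡ? (maps? ℓ)

  hasPreimage? : Decidable HasPreimage
  hasPreimage? m = anyˡ? λ ℓ → maps? ℓ m

  imageIsLine⇒hasImage : ∀ ℓ → ImageIsLine f (toLine ℓ) → HasImage ℓ
  imageIsLine⇒hasImage (d , c) (M , onto) with direction (Line.dir M)
  ... | e , e-dir = (e , ι e (Line.base M)) , λ P →
      (λ p → ∈L⇒ι M e e-dir (proj₂ (onto (f P)) (P , ι⇒toLine d c p , refl)))
    , (λ p → let Q , Q∈ , fQ≡fP = proj₁ (onto (f P)) (ι⇒∈L M e e-dir p)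
             in subst (λ R → ι d R ≡ c) (f-injective fQ≡fP) (toLine⇒ι d c Q∈))

  -- The line through the images of two points of `ℓ` is the image of some line, which contains both
  -- points and so is `ℓ`.
  hasPreimage⇒hasImage : (∀ m → HasPreimage m) → ∀ ℓ → HasImage ℓ
  hasPreimage⇒hasImage pre (d , c) = m , subst (λ ℓ → Maps ℓ m) ℓ′≡ℓ maps
    where
    P = point d c 0#
    Q = point d c 1#
    e = join (f P) (f Q)
    m = e , ι e (f P)
    d′ = proj₁ (proj₁ (pre m))
    c′ = proj₂ (proj₁ (pre m))
    maps = proj₂ (pre m)
    P-on : ι d′ P ≡ c′
    P-on = proj₂ (maps P) refl
    Q-on : ι d′ Q ≡ c′
    Q-on = proj₂ (maps Q) (sym (join-incident (f P) (f Q)))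
    d′≡d : d′ ≡ d
    d′≡d = join-unique (0≢1 ∘ point-injective d c) (trans P-on (sym Q-on))
             (trans (point-ι d c 0#) (sym (point-ι d c 1#)))
    ℓ′≡ℓ : (d′ , c′) ≡ (d , c)
    ℓ′≡ℓ = cong₂ _,_ d′≡d (trans (sym P-on) (trans (cong (λ x → ι x P) d′≡d) (point-ι d c 0#)))

  -- The fundamental theorem of affine geometry.

  module Collineation (image : ∀ ℓ → HasImage ℓ) where
    τ : Direction → Direction
    τ d = proj₁ (proj₁ (image (d , 0#)))

    -- Images of distinct directions would meet, and the preimage of the meeting point would lie on
    -- both parallels. Then `c` is zero and the lines coincide, as do their images.
    image-direction : ∀ d c → proj₁ (proj₁ (image (d , c))) ≡ τ d
    image-direction d c with image (d , c) | image (d , 0#)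
    ... | (e , b) , maps | (e₀ , b₀) , maps₀ = decidable-stable (e ≟ᵈ e₀) λ e≢e₀ →
      let R , eR , e₀R = meet e≢e₀ b b₀
          P = f⁻¹ R
          fP = f∘f⁻¹ R
          c≡0 = trans (sym (proj₂ (maps P) (trans (cong (ι e) fP) eR)))
                      (proj₂ (maps₀ P) (trans (cong (ι e₀) fP) e₀R))
      in e≢e₀ (proj₁ (⊆⇒≡ {e} {b} {e₀} {b₀} λ S eS →
           let fS = f∘f⁻¹ S
               on = proj₂ (maps (f⁻¹ S)) (trans (cong (ι e) fS) eS)
           in trans (cong (ι e₀) (sym fS)) (proj₁ (maps₀ (f⁻¹ S)) (trans on c≡0))))

    τ-incident : ∀ d {P Q} → ι d P ≡ ι d Q → ι (τ d) (f P) ≡ ι (τ d) (f Q)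
    τ-incident d {P} {Q} e with image (d , ι d P) | image-direction d (ι d P)
    ... | (_ , b) , maps | refl = trans (proj₁ (maps P) refl) (sym (proj₁ (maps Q) (sym e)))

    g : Point → Point
    g P = f P ⊝ f zeroP

    g⊕f0 : ∀ P → g P ⊕ f zeroP ≡ f P
    g⊕f0 P = [P⊝Q]⊕Q≡P (f P) (f zeroP)

    g-injective : Injective _≡_ _≡_ g
    g-injective {P} {Q} e = f-injective (trans (sym (g⊕f0 P)) (trans (cong (_⊕ f zeroP) e) (g⊕f0 Q)))

    g-surjective : ∀ R → ∃ λ P → g P ≡ R
    g-surjective R = f⁻¹ (R ⊕ f zeroP) , ⊕-cancelʳ (f zeroP) (trans (g⊕f0 _) (f∘f⁻¹ _))

    g-zero : g zeroP ≡ zeroP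
    g-zero = ⊕-cancelʳ (f zeroP) (trans (g⊕f0 zeroP) (sym (⊕-identityˡ _)))

    g-incident : ∀ d {P Q} → ι d P ≡ ι d Q → ι (τ d) (g P) ≡ ι (τ d) (g Q)
    g-incident d {P} {Q} e = +-cancelʳ (ι (τ d) (f zeroP)) _ _ (begin
      ι (τ d) (g P) + ι (τ d) (f zeroP)  ≡⟨ ι-⊕ (τ d) (g P) (f zeroP) ⟨
      ι (τ d) (g P ⊕ f zeroP)            ≡⟨ cong (ι (τ d)) (g⊕f0 P) ⟩
      ι (τ d) (f P)                      ≡⟨ τ-incident d e ⟩
      ι (τ d) (f Q)                      ≡⟨ cong (ι (τ d)) (g⊕f0 Q) ⟨
      ι (τ d) (g Q ⊕ f zeroP)            ≡⟨ ι-⊕ (τ d) (g Q) (f zeroP) ⟩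
      ι (τ d) (g Q) + ι (τ d) (f zeroP)  ∎)

    g-kernel : ∀ d {P} → ι d P ≡ 0# → ι (τ d) (g P) ≡ 0#
    g-kernel d e = trans (g-incident d (trans e (sym (ι-zero d)))) (trans (cong (ι (τ d)) g-zero) (ι-zero (τ d)))

    -- If τ d = τ e, then the image of g lies on a single line, since every point is
    -- reached from 0 by a step along d followed by a step along e.
    τ-injective : ∀ {d e} → d ≢ e → τ d ≢ τ e
    τ-injective {d} {e} d≢e τd≡τe with g-surjective (point (τ d) 1# 0#)
    ... | P , gP with meet d≢e 0# (ι e P)
    ... | Q , dQ , eQ = 0≢1 (begin
      0#                           ≡⟨ g-kernel d dQ ⟨
      ι (τ d) (g Q)                ≡⟨ cong (λ x → ι x (g Q)) τd≡τe ⟩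
      ι (τ e) (g Q)                ≡⟨ g-incident e eQ ⟩
      ι (τ e) (g P)                ≡⟨ cong (λ x → ι x (g P)) τd≡τe ⟨
      ι (τ d) (g P)                ≡⟨ cong (ι (τ d)) gP ⟩
      ι (τ d) (point (τ d) 1# 0#)  ≡⟨ point-ι (τ d) 1# 0# ⟩
      1#                           ∎)

    -- The sum is the fourth vertex of a parallelogram, the meet of the line of direction `d`
    -- through `y` and the line of direction `e` through `x`; `g` respects both classes.
    g-⊕-independent : ∀ {d e x y} → d ≢ e → ι d x ≡ 0# → ι e y ≡ 0# → g (x ⊕ y) ≡ g x ⊕ g y
    g-⊕-independent {d} {e} {x} {y} d≢e dx ey = meet-unique (τ-injective d≢e)
      (trans (g-incident d (ι-⊕-kernelˡ d y dx)) (sym (ι-⊕-kernelˡ (τ d) (g y) (g-kernel d dx))))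
      (trans (g-incident e (ι-⊕-kernelʳ e x ey)) (sym (ι-⊕-kernelʳ (τ e) (g x) (g-kernel e ey))))

    -- If `x` and `y` share a direction, a vector `z` outside it is added: the triple sum is split
    -- in two ways into sums across distinct directions, and `g z` is cancelled.
    g-⊕ : ∀ x y → g (x ⊕ y) ≡ g x ⊕ g y
    g-⊕ x y with direction x | direction y
    ... | d , dx | d′ , d′y with d ≟ᵈ d′
    ... | no d≢d′ = g-⊕-independent d≢d′ dx d′y
    ... | yes refl with another d
    ... | e , d≢e with dual d≢e
    ... | z , dz≡1 , ez≡0 with direction (y ⊕ z)
    ... | d″ , d″[y⊕z] = ⊕-cancelʳ (g z) (begin
      g (x ⊕ y) ⊕ g z    ≡⟨ g-⊕-independent d≢e (trans (ι-⊕-kernelˡ d y dx) d′y) ez≡0 ⟨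
      g ((x ⊕ y) ⊕ z)    ≡⟨ cong g (⊕-assoc x y z) ⟩
      g (x ⊕ (y ⊕ z))    ≡⟨ g-⊕-independent d≢d″ dx d″[y⊕z] ⟩
      g x ⊕ g (y ⊕ z)    ≡⟨ cong (g x ⊕_) (g-⊕-independent d≢e d′y ez≡0) ⟩
      g x ⊕ (g y ⊕ g z)  ≡⟨ ⊕-assoc (g x) (g y) (g z) ⟨
      (g x ⊕ g y) ⊕ g z  ∎)
      where
      d≢d″ : d ≢ d″
      d≢d″ refl = 0≢1 (trans (sym d″[y⊕z]) (trans (ι-⊕-kernelˡ d z d′y) dz≡1))

    e₁ e₂ : Point
    e₁ = 1# , 0#
    e₂ = 0# , 1#

    1≢0 : 1# ≢ 0#
    1≢0 = 0≢1 ∘ sym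

    e₁≢0 : e₁ ≢ zeroP
    e₁≢0 = 1≢0 ∘ cong proj₁

    direction-e₁ : ι (just 0#) e₁ ≡ 0#
    direction-e₁ = trans (+-identityˡ _) (zeroˡ 1#)

    ge₁≢0 : g e₁ ≢ zeroP
    ge₁≢0 e = e₁≢0 (g-injective (trans e (sym g-zero)))

    kernel-· : ∀ d {x} α → ι d x ≡ 0# → ι d (α · x) ≡ 0#
    kernel-· d {x} α dx = trans (ι-· d α x) (trans (cong (α *_) dx) (zeroʳ α))

    -- The multiples of `e₁` stay on the line through 0 and `g e₁`; the factor there defines the
    -- candidate automorphism.
    scale : ∀ α → Σ Carrier λ t → g (α · e₁) ≡ t · g e₁
    scale α = kernel-span (τ (just 0#)) ge₁≢0 (g-kernel (just 0#) direction-e₁)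
      (g-kernel (just 0#) (kernel-· (just 0#) α direction-e₁))

    σ : Carrier → Carrier
    σ α = proj₁ (scale α)

    σ-e₁ : ∀ α → g (α · e₁) ≡ σ α · g e₁
    σ-e₁ α = proj₂ (scale α)

    -- α x lies on the line through 0 and x and on the parallel through α e to the line
    -- joining e and x; g takes this figure to the corresponding one for g e and g x.
    g-·-from : ∀ e → (∀ α → g (α · e) ≡ σ α · g e) →
      ∀ d {x} → ι d x ≡ 0# → ι d e ≢ 0# → ∀ α → g (α · x) ≡ σ α · g x
    g-·-from e ge d {x} dx de α = meet-unique (τ-injective d≢d′)
      (trans (g-kernel d (kernel-· d α dx)) (sym (kernel-· (τ d) (σ α) (g-kernel d dx))))
      (begin
        ι (τ d′) (g (α · x))    ≡⟨ g-incident d′ αx≡αe ⟩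
        ι (τ d′) (g (α · e))    ≡⟨ cong (ι (τ d′)) (ge α) ⟩
        ι (τ d′) (σ α · g e)    ≡⟨ ι-· (τ d′) (σ α) (g e) ⟩
        σ α * ι (τ d′) (g e)    ≡⟨ cong (σ α *_) (g-incident d′ (join-incident x e)) ⟨
        σ α * ι (τ d′) (g x)    ≡⟨ ι-· (τ d′) (σ α) (g x) ⟨
        ι (τ d′) (σ α · g x)    ∎)
      where
      d′ = join x e
      d≢d′ : d ≢ d′
      d≢d′ eq = de (trans (cong (λ k → ι k e) eq)
        (trans (sym (join-incident x e)) (trans (cong (λ k → ι k x) (sym eq)) dx)))
      αx≡αe : ι d′ (α · x) ≡ ι d′ (α · e)
      αx≡αe = trans (ι-· d′ α x) (trans (cong (α *_) (join-incident x e)) (sym (ι-· d′ α e)))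

    g-·-e₂ : ∀ α → g (α · e₂) ≡ σ α · g e₂
    g-·-e₂ = g-·-from e₁ σ-e₁ nothing refl 1≢0

    -- Vectors off the line of `e₁` are compared with `e₁`. On that line the comparison degenerates,
    -- and `e₂`, itself settled through `e₁`, takes its place.
    g-· : ∀ α x → g (α · x) ≡ σ α · g x
    g-· α x with direction x
    ... | d , dx with ι d e₁ ≟ 0#
    ... | no de₁≢0 = g-·-from e₁ σ-e₁ d dx de₁≢0 α
    ... | yes de₁≡0 = g-·-from e₂ g-·-e₂ d dx de₂≢0 α
      where
      de₂≢0 : ι d e₂ ≢ 0#
      de₂≢0 de₂≡0 = 1≢0 (trans (sym (trans (cong (1# +_) (zeroˡ 0#)) (+-identityʳ 1#)))
        (trans (cong (λ k → ι k e₂) (join-unique {just 0#} {d} {e₁} {zeroP} e₁≢0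
            (trans direction-e₁ (sym (ι-zero (just 0#)))) (trans de₁≡0 (sym (ι-zero d)))))
          de₂≡0))

    σ-injective : Injective _≡_ _≡_ σ
    σ-injective {a} {b} e = ·-cancelʳ e₁≢0
      (g-injective (trans (σ-e₁ a) (trans (cong (_· g e₁) e) (sym (σ-e₁ b)))))

    -- Each law is a law of `g` on multiples of `e₁`, with the nonzero vector `g e₁` cancelled.
    σ-aut : FieldAut
    σ-aut = record
      { σ     = σ
      ; σ-bij = σ-injective , λ y → let x , e = injective⇒surjective σ σ-injective y
                                    in x , λ { refl → e }
      ; σ-+   = λ a b → ·-cancelʳ ge₁≢0 (begin
          σ (a + b) · g e₁            ≡⟨ σ-e₁ (a + b) ⟨
          g ((a + b) · e₁)            ≡⟨ cong g (·-distribʳ a b e₁) ⟩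
          g ((a · e₁) ⊕ (b · e₁))     ≡⟨ g-⊕ (a · e₁) (b · e₁) ⟩
          g (a · e₁) ⊕ g (b · e₁)     ≡⟨ cong₂ _⊕_ (σ-e₁ a) (σ-e₁ b) ⟩
          (σ a · g e₁) ⊕ (σ b · g e₁) ≡⟨ ·-distribʳ (σ a) (σ b) (g e₁) ⟨
          (σ a + σ b) · g e₁          ∎)
      ; σ-*   = λ a b → ·-cancelʳ ge₁≢0 (begin
          σ (a * b) · g e₁    ≡⟨ σ-e₁ (a * b) ⟨
          g ((a * b) · e₁)    ≡⟨ cong g (·-assoc a b e₁) ⟩
          g (a · (b · e₁))    ≡⟨ g-· a (b · e₁) ⟩
          σ a · g (b · e₁)    ≡⟨ cong (σ a ·_) (σ-e₁ b) ⟩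
          σ a · (σ b · g e₁)  ≡⟨ ·-assoc (σ a) (σ b) (g e₁) ⟨
          (σ a * σ b) · g e₁  ∎)
      ; σ-1   = ·-cancelʳ ge₁≢0 (begin
          σ 1# · g e₁   ≡⟨ σ-e₁ 1# ⟨
          g (1# · e₁)   ≡⟨ cong g (·-identityˡ e₁) ⟩
          g e₁          ≡⟨ ·-identityˡ (g e₁) ⟨
          1# · g e₁     ∎)
      }

    semiAffine : IsSemiAffine f
    semiAffine = σ-aut , g , f zeroP
      , (g-injective , λ y → let x , e = g-surjective y in x , λ { refl → e })
      , g-⊕ , g-· , λ x → sym (g⊕f0 x)

  -- Secants and external lines of a preimage that is not a line.

  module Fragment (d₀ : Direction) (c₀ : Carrier) (¬pre : ¬ HasPreimage (d₀ , c₀)) where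

    S : Carrier → Point
    S k = f⁻¹ (point d₀ c₀ k)

    fS : ∀ k → ι d₀ (f (S k)) ≡ c₀
    fS k = trans (cong (ι d₀) (f∘f⁻¹ _)) (point-ι d₀ c₀ k)

    S-injective : Injective _≡_ _≡_ S
    S-injective = point-injective d₀ c₀ ∘ from-injective perm

    S-complete : ∀ P → ι d₀ (f P) ≡ c₀ → ∃ λ k → P ≡ S k
    S-complete P refl with point-surjective d₀ (f P)
    ... | k , e = k , f-injective (trans e (sym (f∘f⁻¹ _)))

    Bad : Direction × Carrier → Set
    Bad ℓ = ¬ HasImage ℓ

    -- The field indexes both the points of `S` and the lines of class `d`, so this is a self-map,
    -- injective exactly when surjective. Its crowded indices are the points on secants of class
    -- `d`.
    φ : Direction → Carrier → Carrier
    φ d k = ι d (S k)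

    joinˢ : Carrier → Carrier → Direction
    joinˢ k l = join (S k) (S l)

    -- A line as image would share two points with `(d₀ , c₀)`, hence equal it, against `¬pre`.
    secant⇒bad : ∀ d {k l} → k ≢ l → φ d k ≡ φ d l → Bad (d , φ d k)
    secant⇒bad d {k} {l} k≢l e ((d′ , c′) , maps)
      with join-unique {d′} {d₀} (k≢l ∘ S-injective ∘ f-injective)
             (trans (proj₁ (maps (S k)) refl) (sym (proj₁ (maps (S l)) (sym e))))
             (trans (fS k) (sym (fS l)))
    ... | refl with trans (sym (proj₁ (maps (S k)) refl)) (fS k)
    ... | refl = ¬pre ((d , φ d k) , maps)

    External : Direction × Carrier → Set
    External (d , c) = ∀ k → φ d k ≢ c

    -- An image of another direction would meet `(d₀ , c₀)`, and the preimage of the meeting point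
    -- would be a point of `S` on the external line.
    external-image : ∀ {d c} → External (d , c) → ((m , _) : HasImage (d , c)) → proj₁ m ≡ d₀
    external-image {d} {c} ext ((d′ , c′) , maps) = decidable-stable (d′ ≟ᵈ d₀) λ d′≢d₀ →
      let R , d′R , d₀R = meet d′≢d₀ c′ c₀
          P = f⁻¹ R
          fP = f∘f⁻¹ R
          k , P≡Sk = S-complete P (trans (cong (ι d₀) fP) d₀R)
      in ext k (trans (cong (ι d) (sym P≡Sk)) (proj₂ (maps P) (trans (cong (ι d′) fP) d′R)))

    -- Both images have direction `d₀`. If the lines crossed, the images would share a point and
    -- coincide, and so would the lines.
    external-parallel : ∀ {d c e b} → External (d , c) → External (e , b) →
      HasImage (d , c) → HasImage (e , b) → d ≡ e
    external-parallel {d} {c} {e} {b} ext ext′ im@((_ , c′) , maps) im′@((_ , b′) , maps′)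
      with external-image {d} {c} ext im | external-image {e} {b} ext′ im′
    ... | refl | refl = decidable-stable (d ≟ᵈ e) λ d≢e →
      let P , dP , eP = meet d≢e c b
          c′≡b′ = trans (sym (proj₁ (maps P) dP)) (proj₁ (maps′ P) eP)
      in d≢e (proj₁ (⊆⇒≡ {d} {c} {e} {b} λ Q dQ →
           proj₂ (maps′ Q) (trans (proj₁ (maps Q) dQ) c′≡b′)))

    goodExternal? : Dec (∃ λ ℓ → External ℓ × HasImage ℓ)
    goodExternal? = anyˡ? λ (d , c) → all? (λ k → ¬? (φ d k ≟ c)) ×-dec hasImage? (d , c)

    exceptional : ∃ λ C → ∀ d c → d ≢ C → External (d , c) → Bad (d , c)
    exceptional with goodExternal?
    ... | yes ((C , b) , ext , im) = C , λ d c d≢C ext′ im′ →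
      d≢C (external-parallel {d} {c} {C} {b} ext′ ext im′ im)
    -- With no good external line, the choice of class is arbitrary.
    ... | no none = nothing , λ d c _ ext′ im′ → none ((d , c) , ext′ , im′)

    -- S has q points, so it would otherwise fill a line.
    noncollinear : ∀ d s → ∃ λ k → φ d k ≢ φ d s
    noncollinear d s = ¬∀⇒∃¬ (λ k → φ d k ≟ φ d s) λ all → ¬pre ((d , φ d s) , λ P →
        (λ dP → let k , Sk≡P = fills all P dP in subst (λ Q → ι d₀ (f Q) ≡ c₀) Sk≡P (fS k))
      , (λ d₀fP → let k , P≡Sk = S-complete P d₀fP in trans (cong (ι d) P≡Sk) (all k)))
      where
      coordinate : Carrier → Carrier
      coordinate k = proj₁ (point-surjective d (S k))
      fills : (∀ k → φ d k ≡ φ d s) → ∀ P → ι d P ≡ φ d s → ∃ λ k → S k ≡ P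
      fills all P dP =
        let at : ∀ k → S k ≡ point d (φ d s) (coordinate k)
            at k = trans (proj₂ (point-surjective d (S k))) (cong (λ c → point d c (coordinate k)) (all k))
            coordinate-injective : Injective _≡_ _≡_ coordinate
            coordinate-injective {a} {b} e =
              S-injective (trans (at a) (trans (cong (point d (φ d s)) e) (sym (at b))))
            t , P≡ = point-surjective d P
            k , e = injective⇒surjective coordinate coordinate-injective t
        in k , trans (at k) (trans (cong₂ (point d) (sym dP) e) (sym P≡))

    -- The image of an external line is parallel to (d₀ , c₀), so the image of a parallel
    -- line through S s could only be (d₀ , c₀) itself.
    external-tangent : ∀ {d c s} → External (d , c) → HasImage (d , c) →
      ∃ (λ k → φ d k ≢ φ d s) → Bad (d , φ d s)
    external-tangent {d} {c} {s} ext im@((_ , c′) , maps) (k , k∉) ((e , b) , maps′)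
      with external-image {d} {c} ext im
    ... | refl with e ≟ᵈ d₀
    ... | yes refl = k∉ (proj₂ (maps′ (S k)) (trans (fS k) (trans (sym (fS s)) (proj₁ (maps′ (S s)) refl))))
    ... | no e≢d₀ =
      let R , eR , d₀R = meet e≢d₀ b c′
          P = f⁻¹ R
          fP = f∘f⁻¹ R
      in ext s (trans (sym (proj₂ (maps′ P) (trans (cong (ι e) fP) eR)))
                      (proj₂ (maps P) (trans (cong (ι d₀) fP) d₀R)))

    -- The secant makes `φ d` non-injective, hence non-surjective, so the class has an external
    -- line. Either that line is bad, or `external-tangent` makes the line through `S t` bad.
    second-bad : ∀ d {k l t} → k ≢ l → φ d k ≡ φ d l → φ d t ≢ φ d k → ∃ λ c → c ≢ φ d k × Bad (d , c)
    second-bad d {k} {l} {t} k≢l e t∉ with any? (λ c → all? λ j → ¬? (φ d j ≟ c))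
    ... | no none = ⊥-elim (k≢l (surjective⇒injective (φ d) onto e))
      where
      onto : ∀ c → ∃ λ j → φ d j ≡ c
      onto c = decidable-stable (any? λ j → φ d j ≟ c) λ miss → none (c , λ j e′ → miss (j , e′))
    ... | yes (c , ext) with hasImage? (d , c)
    ... | no bad = c , (λ c≡ → ext k (sym c≡)) , bad
    ... | yes im = φ d t , t∉ , external-tangent {d} {c} ext im (k , t∉ ∘ sym)

    -- Counting bad lines by pairs of a class and a point.

    module Exceptional (C : Direction)
      (external⇒bad : ∀ d c → d ≢ C → External (d , c) → Bad (d , c)) where

      -- The exceptional class is left alone, so that its lines are indexed by their intercepts.
      ρ : Direction → Carrier → Carrier
      ρ d with d ≟ᵈ C
      ... | yes _ = λ s → s
      ... | no _ = lonelyExtension (φ d)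

      ρ-injective : ∀ d → Injective _≡_ _≡_ (ρ d)
      ρ-injective d e with d ≟ᵈ C
      ... | yes _ = e
      ... | no _ = lonelyExtension-injective (φ d) e

      ρ-exceptional : ∀ c → ρ C c ≡ c
      ρ-exceptional c with C ≟ᵈ C
      ... | yes _ = refl
      ... | no C≢C = ⊥-elim (C≢C refl)

      -- If this line misses `S`, it is bad as an external line outside `C`. If it passes through
      -- some `S k`, then `k` is crowded too and the line is a secant.
      crowded⇒bad : ∀ {d} → d ≢ C → ∀ {s} → Crowded (φ d) s → Bad (d , ρ d s)
      crowded⇒bad {d} d≢C {s} crowded with d ≟ᵈ C
      ... | yes d≡C = ⊥-elim (d≢C d≡C)
      ... | no _ with any? (λ k → φ d k ≟ lonelyExtension (φ d) s)
      ... | no miss = external⇒bad d _ d≢C λ k e → miss (k , e)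
      ... | yes (k , e) with lonelyExtension-crowded (φ d) s k crowded e
      ... | l , l≢k , φl≡φk = subst (λ c → Bad (d , c)) e (secant⇒bad d (l≢k ∘ sym) (sym φl≡φk))

      -- Being injective, it reduces distinctness of lines to distinctness of pairs. In class `C`
      -- the second component is an intercept rather than a point.
      Φ : Direction × Carrier → Direction × Carrier
      Φ (d , s) = d , ρ d s

      Φ-injective : Injective _≡_ _≡_ Φ
      Φ-injective {d , s} {e , t} eq with cong proj₁ eq
      ... | refl = cong (d ,_) (ρ-injective d (cong proj₂ eq))

      DoublySecant : Carrier → Set
      DoublySecant s = ∃ λ d → ∃ λ e → d ≢ C × e ≢ C × d ≢ e × Crowded (φ d) s × Crowded (φ e) s

      doublySecant? : Decidable DoublySecant
      doublySecant? s = anyᵈ? λ d → anyᵈ? λ e → ¬? (d ≟ᵈ C) ×-dec ¬? (e ≟ᵈ C) ×-dec ¬? (d ≟ᵈ e)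
        ×-dec crowded? (φ d) s ×-dec crowded? (φ e) s

      BadFamily : Set
      BadFamily = Σ (Carrier × Fin 2 → Direction × Carrier) λ w →
        Injective _≡_ _≡_ w × (∀ i → Bad (Φ (w i)))

      -- The case of two secants outside `C` through every point.

      module _ (two : ∀ s → DoublySecant s) where
        private
          w : Carrier × Fin 2 → Direction × Carrier
          w (s , 0F) = proj₁ (two s) , s
          w (s , 1F) = proj₁ (proj₂ (two s)) , s

          w-injective : ∀ i j → w i ≡ w j → i ≡ j
          w-injective (s , 0F) (t , 0F) e = cong (_, 0F) (cong proj₂ e)
          w-injective (s , 1F) (t , 1F) e = cong (_, 1F) (cong proj₂ e)
          w-injective (s , 0F) (t , 1F) e with cong proj₂ e
          ... | refl = let _ , _ , _ , _ , d≢e , _ = two s in ⊥-elim (d≢e (cong proj₁ e))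
          w-injective (s , 1F) (t , 0F) e with cong proj₂ e
          ... | refl = let _ , _ , _ , _ , d≢e , _ = two s in ⊥-elim (d≢e (sym (cong proj₁ e)))

          w-bad : ∀ i → Bad (Φ (w i))
          w-bad (s , 0F) = let _ , _ , d≢C , _ , _ , c , _ = two s in crowded⇒bad d≢C c
          w-bad (s , 1F) = let _ , _ , _ , e≢C , _ , _ , c = two s in crowded⇒bad e≢C c

        generic-family : BadFamily
        generic-family = w , w-injective _ _ , w-bad

      -- Here S lies on two lines through S s₀: N, in the exceptional class C, and M, of direction d₁.
      module _ (s₀ : Carrier) (¬two : ¬ DoublySecant s₀) where
        private
          α₀ : Carrier
          α₀ = proj₁ (noncollinear C s₀)

          α₀∉N : φ C α₀ ≢ φ C s₀
          α₀∉N = proj₂ (noncollinear C s₀)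

          d₁ : Direction
          d₁ = joinˢ s₀ α₀

          α₀∈M : φ d₁ α₀ ≡ φ d₁ s₀
          α₀∈M = sym (join-incident (S s₀) (S α₀))

          d₁≢C : d₁ ≢ C
          d₁≢C e = α₀∉N (subst (λ d → φ d α₀ ≡ φ d s₀) e α₀∈M)

          α₀≢s₀ : α₀ ≢ s₀
          α₀≢s₀ e = α₀∉N (cong (φ C) e)

          β₀ : Carrier
          β₀ = proj₁ (noncollinear d₁ s₀)

          β₀∉M : φ d₁ β₀ ≢ φ d₁ s₀
          β₀∉M = proj₂ (noncollinear d₁ s₀)

          -- A point off both lines would give `s₀` a secant outside `C` other than M, against
          -- `¬two`. Hence `β₀`, chosen off M, lies on N.
          ∉N⇒∈M : ∀ k → φ C k ≢ φ C s₀ → φ d₁ k ≡ φ d₁ s₀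
          ∉N⇒∈M k k∉N = decidable-stable (φ d₁ k ≟ φ d₁ s₀) λ k∉M → ¬two
            ( joinˢ s₀ k , d₁
            , (λ e → k∉N (subst (λ d → φ d k ≡ φ d s₀) e (k∈ k)))
            , d₁≢C
            , (λ e → k∉M (subst (λ d → φ d k ≡ φ d s₀) e (k∈ k)))
            , (k , (λ e → k∉N (cong (φ C) e)) , k∈ k)
            , (α₀ , α₀≢s₀ , α₀∈M))
            where
            k∈ : ∀ k → φ (joinˢ s₀ k) k ≡ φ (joinˢ s₀ k) s₀
            k∈ k = sym (join-incident (S s₀) (S k))

          β₀∈N : φ C β₀ ≡ φ C s₀
          β₀∈N = decidable-stable (φ C β₀ ≟ φ C s₀) λ β₀∉N → β₀∉M (∉N⇒∈M β₀ β₀∉N)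

          β₀≢s₀ : β₀ ≢ s₀
          β₀≢s₀ e = β₀∉M (cong (φ d₁) e)

          ∈N⇒∉M : ∀ {k} → k ≢ s₀ → φ C k ≡ φ C s₀ → φ d₁ k ≢ φ d₁ s₀
          ∈N⇒∉M k≢s₀ k∈N k∈M = k≢s₀ (S-injective (meet-unique d₁≢C k∈M k∈N))

          c₂ : ∃ λ c → c ≢ φ C s₀ × Bad (C , c)
          c₂ = second-bad C (β₀≢s₀ ∘ sym) (sym β₀∈N) α₀∉N

          -- In direction `C` the secant would put `S a` on N; in direction `d₁` it would put `S b`
          -- on M, which meets N only in `S s₀`.
          cross : ∀ a b → φ C a ≢ φ C s₀ → φ C b ≡ φ C s₀ → b ≢ s₀ → joinˢ a b ≢ C × joinˢ a b ≢ d₁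
          cross a b a∉N b∈N b≢s₀ =
              (λ e → a∉N (trans (subst (λ d → φ d a ≡ φ d b) e (join-incident (S a) (S b))) b∈N))
            , (λ e → ∈N⇒∉M b≢s₀ b∈N (trans
                (sym (subst (λ d → φ d a ≡ φ d b) e (join-incident (S a) (S b)))) (∉N⇒∈M a a∉N)))

          data Kind : Carrier → Set where
            base : Kind s₀
            apex : Kind α₀
            onN  : ∀ {k} → φ C k ≡ φ C s₀ → k ≢ s₀ → Kind k
            onM  : ∀ {k} → φ C k ≢ φ C s₀ → k ≢ α₀ → Kind k

          kind : ∀ k → Kind k
          kind k with φ C k ≟ φ C s₀
          kind k | yes k∈N with k ≟ s₀
          ... | yes refl = base
          ... | no k≢s₀ = onN k∈N k≢s₀
          kind k | no k∉N with k ≟ α₀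
          ... | yes refl = apex
          ... | no k≢α₀ = onM k∉N k≢α₀

          -- The index need not be the point of its pairs. A secant from `α₀` to N contributes both
          -- its ends, charged to the end on N; a secant from `β₀` to M contributes only its end on
          -- M. The index `s₀` is charged with the two bad lines of `C`, and `α₀` with the points
          -- `α₀` and `s₀` of M.
          u : ∀ {k} → Kind k → Fin 2 → Direction × Carrier
          u base 0F = C , φ C s₀
          u base 1F = C , proj₁ c₂
          u apex 0F = d₁ , α₀
          u apex 1F = d₁ , s₀
          u {k} (onN _ _) 0F = joinˢ α₀ k , k
          u {k} (onN _ _) 1F = joinˢ α₀ k , α₀
          u {k} (onM _ _) 0F = d₁ , k
          u {k} (onM _ _) 1F = joinˢ k β₀ , k

          bad-C : ∀ c → Bad (C , c) → Bad (Φ (C , c))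
          bad-C c = subst (λ x → Bad (C , x)) (sym (ρ-exceptional c))

          u-bad : ∀ {k} (K : Kind k) b → Bad (Φ (u K b))
          u-bad base 0F = bad-C _ (secant⇒bad C (β₀≢s₀ ∘ sym) (sym β₀∈N))
          u-bad base 1F = bad-C _ (proj₂ (proj₂ c₂))
          u-bad apex 0F = crowded⇒bad d₁≢C (s₀ , α₀≢s₀ ∘ sym , sym α₀∈M)
          u-bad apex 1F = crowded⇒bad d₁≢C (α₀ , α₀≢s₀ , α₀∈M)
          u-bad {k} (onN k∈N k≢s₀) 0F = crowded⇒bad (proj₁ (cross α₀ k α₀∉N k∈N k≢s₀))
            (α₀ , (λ e → α₀∉N (trans (cong (φ C) e) k∈N)) , join-incident (S α₀) (S k))
          u-bad {k} (onN k∈N k≢s₀) 1F = crowded⇒bad (proj₁ (cross α₀ k α₀∉N k∈N k≢s₀))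
            (k , (λ e → α₀∉N (trans (cong (φ C) (sym e)) k∈N)) , sym (join-incident (S α₀) (S k)))
          u-bad {k} (onM k∉N k≢α₀) 0F = crowded⇒bad d₁≢C
            (α₀ , k≢α₀ ∘ sym , trans α₀∈M (sym (∉N⇒∈M k k∉N)))
          u-bad {k} (onM k∉N k≢α₀) 1F = crowded⇒bad (proj₁ (cross k β₀ k∉N β₀∈N β₀≢s₀))
            (β₀ , (λ e → k∉N (trans (cong (φ C) (sym e)) β₀∈N)) , sym (join-incident (S k) (S β₀)))

          -- Equal directions from `α₀` give the same line, which lies outside class `C` and so
          -- meets N only once.
          joinˢ-α₀-injective : ∀ {k l} → φ C k ≡ φ C s₀ → k ≢ s₀ → φ C l ≡ φ C s₀ →
            joinˢ α₀ k ≡ joinˢ α₀ l → k ≡ l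
          joinˢ-α₀-injective {k} {l} k∈N k≢s₀ l∈N e = S-injective
            (meet-unique (proj₁ (cross α₀ k α₀∉N k∈N k≢s₀))
              (trans (sym (join-incident (S α₀) (S k)))
                (subst (λ d → φ d α₀ ≡ φ d l) (sym e) (join-incident (S α₀) (S l))))
              (trans k∈N (sym l∈N)))

          off-C : ∀ {k} (K : Kind k) b → k ≢ s₀ → proj₁ (u K b) ≢ C
          off-C base b k≢s₀ _ = k≢s₀ refl
          off-C apex 0F _ = d₁≢C
          off-C apex 1F _ = d₁≢C
          off-C {k} (onN k∈N k≢s₀) 0F _ = proj₁ (cross α₀ k α₀∉N k∈N k≢s₀)
          off-C {k} (onN k∈N k≢s₀) 1F _ = proj₁ (cross α₀ k α₀∉N k∈N k≢s₀)
          off-C (onM _ _) 0F _ = d₁≢C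
          off-C {k} (onM k∉N _) 1F _ = proj₁ (cross k β₀ k∉N β₀∈N β₀≢s₀)

          base-C : ∀ b → proj₁ (u base b) ≡ C
          base-C 0F = refl
          base-C 1F = refl

          apex-onN : ∀ {k} (k∈N : φ C k ≡ φ C s₀) (k≢s₀ : k ≢ s₀) b c → u apex b ≢ u (onN k∈N k≢s₀) c
          apex-onN {k} k∈N k≢s₀ b c e =
            proj₂ (cross α₀ k α₀∉N k∈N k≢s₀) (trans (sym (onN-dir c)) (trans (sym (cong proj₁ e)) (apex-dir b)))
            where
            apex-dir : ∀ b → proj₁ (u apex b) ≡ d₁
            apex-dir 0F = refl
            apex-dir 1F = refl
            onN-dir : ∀ c → proj₁ (u (onN k∈N k≢s₀) c) ≡ joinˢ α₀ k
            onN-dir 0F = refl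
            onN-dir 1F = refl

          onM-point : ∀ {k} (k∉N : φ C k ≢ φ C s₀) (k≢α₀ : k ≢ α₀) b → proj₂ (u (onM k∉N k≢α₀) b) ≡ k
          onM-point _ _ 0F = refl
          onM-point _ _ 1F = refl

          apex-onM : ∀ {k} (k∉N : φ C k ≢ φ C s₀) (k≢α₀ : k ≢ α₀) b c → u apex b ≢ u (onM k∉N k≢α₀) c
          apex-onM k∉N k≢α₀ 0F c e = k≢α₀ (sym (trans (cong proj₂ e) (onM-point k∉N k≢α₀ c)))
          apex-onM k∉N k≢α₀ 1F c e = k∉N (cong (φ C) (sym (trans (cong proj₂ e) (onM-point k∉N k≢α₀ c))))

          onN-onM : ∀ {k l} (k∈N : φ C k ≡ φ C s₀) (k≢s₀ : k ≢ s₀)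
            (l∉N : φ C l ≢ φ C s₀) (l≢α₀ : l ≢ α₀) b c → u (onN k∈N k≢s₀) b ≢ u (onM l∉N l≢α₀) c
          onN-onM k∈N k≢s₀ l∉N l≢α₀ 0F c e =
            l∉N (trans (cong (φ C) (sym (trans (cong proj₂ e) (onM-point l∉N l≢α₀ c)))) k∈N)
          onN-onM k∈N k≢s₀ l∉N l≢α₀ 1F c e = l≢α₀ (sym (trans (cong proj₂ e) (onM-point l∉N l≢α₀ c)))

          base-only : ∀ {l} (L : Kind l) b c → u base b ≡ u L c → l ≡ s₀
          base-only {l} L b c e = decidable-stable (l ≟ s₀) λ l≢s₀ →
            off-C L c l≢s₀ (trans (sym (cong proj₁ e)) (base-C b))

          -- Class `C` marks `base`. Elsewhere the point is the index for `onM`, and is `α₀` or on N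
          -- otherwise; class `d₁` then tells `apex` from `onN`, where the direction determines the
          -- index.
          u-injective₁ : ∀ {k l} (K : Kind k) (L : Kind l) b c → u K b ≡ u L c → k ≡ l
          u-injective₁ base L b c e = sym (base-only L b c e)
          u-injective₁ K base b c e = base-only K c b (sym e)
          u-injective₁ apex apex b c e = refl
          u-injective₁ apex (onN p r) b c e = ⊥-elim (apex-onN p r b c e)
          u-injective₁ apex (onM p r) b c e = ⊥-elim (apex-onM p r b c e)
          u-injective₁ (onN p r) apex b c e = ⊥-elim (apex-onN p r c b (sym e))
          u-injective₁ (onM p r) apex b c e = ⊥-elim (apex-onM p r c b (sym e))
          u-injective₁ (onN p r) (onM p′ r′) b c e = ⊥-elim (onN-onM p r p′ r′ b c e)
          u-injective₁ (onM p r) (onN p′ r′) b c e = ⊥-elim (onN-onM p′ r′ p r c b (sym e))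
          u-injective₁ (onM p r) (onM p′ r′) b c e =
            trans (sym (onM-point p r b)) (trans (cong proj₂ e) (onM-point p′ r′ c))
          u-injective₁ (onN p r) (onN p′ r′) 0F 0F e = cong proj₂ e
          u-injective₁ (onN p r) (onN p′ r′) 1F 1F e = joinˢ-α₀-injective p r p′ (cong proj₁ e)
          u-injective₁ (onN p r) (onN p′ r′) 0F 1F e = joinˢ-α₀-injective p r p′ (cong proj₁ e)
          u-injective₁ (onN p r) (onN p′ r′) 1F 0F e = joinˢ-α₀-injective p r p′ (cong proj₁ e)

          u-0≢1 : ∀ {k} (K : Kind k) → u K 0F ≢ u K 1F
          u-0≢1 base e = proj₁ (proj₂ c₂) (sym (cong proj₂ e))
          u-0≢1 apex e = α₀≢s₀ (cong proj₂ e)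
          u-0≢1 (onN k∈N _) e = α₀∉N (trans (cong (φ C) (sym (cong proj₂ e))) k∈N)
          u-0≢1 {k} (onM k∉N _) e = proj₂ (cross k β₀ k∉N β₀∈N β₀≢s₀) (sym (cong proj₁ e))

          u-injective₂ : ∀ {k} (K : Kind k) b c → u K b ≡ u K c → b ≡ c
          u-injective₂ K 0F 0F e = refl
          u-injective₂ K 1F 1F e = refl
          u-injective₂ K 0F 1F e = ⊥-elim (u-0≢1 K e)
          u-injective₂ K 1F 0F e = ⊥-elim (u-0≢1 K (sym e))

        degenerate-family : BadFamily
        degenerate-family = (λ (k , b) → u (kind k) b) , injective , λ (k , b) → u-bad (kind k) b
          where
          injective : Injective _≡_ _≡_ (λ (k , b) → u (kind k) b)
          injective {k , b} {l , c} e with u-injective₁ (kind k) (kind l) b c e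
          ... | refl = cong (k ,_) (u-injective₂ (kind k) b c e)

      family : BadFamily
      family with all? doublySecant?
      ... | yes two = generic-family two
      ... | no ¬all = let s₀ , ¬two = ¬∀⇒∃¬ doublySecant? ¬all in degenerate-family s₀ ¬two

      coaffinity : BadFamily → CoaffinityAtLeast f (2 Nat.* q)
      coaffinity (w , w-injective , w-bad) = (λ i → toLine (Φ (w (index i))))
        , (λ i j same → index-injective (w-injective
            (Φ-injective (toLine-injective (Φ (w (index i))) (Φ (w (index j))) same))))
        , (λ i im → w-bad (index i) (imageIsLine⇒hasImage (Φ (w (index i))) im))
        where
        index : Fin (2 Nat.* q) → Carrier × Fin 2
        index i = Inverse.from finite (proj₂ (remQuot {2} q i)) , proj₁ (remQuot {2} q i)
        index-injective : Injective _≡_ _≡_ index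
        index-injective {i} {j} e = begin
          i                                                            ≡⟨ Fin.combine-remQuot {2} q i ⟨
          combine (proj₁ (remQuot {2} q i)) (proj₂ (remQuot {2} q i))  ≡⟨ cong₂ combine (cong proj₂ e) (from-injective finite (cong proj₁ e)) ⟩
          combine (proj₁ (remQuot {2} q j)) (proj₂ (remQuot {2} q j))  ≡⟨ Fin.combine-remQuot {2} q j ⟩
          j                                                            ∎

  -- The search is for a line that is no image, not for one without an image, since the count starts
  -- from its preimage `S`. If there is none, `f` is a collineation.
  ¬semiAffine⇒coaffinity : ¬ IsSemiAffine f → CoaffinityAtLeast f (2 Nat.* q)
  ¬semiAffine⇒coaffinity ¬semi with anyˡ? (¬? ∘ hasPreimage?)
  ... | no none = ⊥-elim (¬semi (Collineation.semiAffine (hasPreimage⇒hasImage λ m →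
          decidable-stable (hasPreimage? m) λ ¬pre → none (m , ¬pre))))
  ... | yes ((d₀ , c₀) , ¬pre) =
    let C , external⇒bad = exceptional
        open Exceptional C external⇒bad
    in coaffinity family
    where open Fragment d₀ c₀ ¬pre

open import Data.Nat using (_*_)

theorem8p1 : (q : ℕ) (F : FiniteField q) → 4 ≤ q →
    (f : Plane.Point F ↔ Plane.Point F) →
    ¬ Plane.IsSemiAffine F (Inverse.to f) →
    Plane.CoaffinityAtLeast F (Inverse.to f) (2 * q)
theorem8p1 q F _ f ¬semi = Permutation.¬semiAffine⇒coaffinity F f ¬semi
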